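{- Let $\kappa$ be a cardinal with $\omega_{1}\leq\kappa\leq\mathfrak c$ and $\mathrm{cf}(\kappa)>\omega$. Then $\omega^{*}\rightarrow(P_{\kappa})^{1}_{2}$.
   Context: $\mathfrak c=2^{\aleph_0}$. $\omega$ is the countably infinite discrete space, $\beta(\omega)$ its Stone-Čech compactification, and $\omega^{*}=\beta(\omega)\setminus\omega$ with the subspace topology. For an infinite cardinal $\kappa$, $P_\kappa$ is the set $\kappa+1=\kappa\cup\{\kappa\}$ with the topology in which $U\subseteq\kappa+1$ is open if and only if either $U\subseteq\kappa$ or there is $\xi<\kappa$ with $(\xi,\kappa]\subseteq U$. For topological spaces $X,Y$, the relation $X\rightarrow(Y)^{1}_{2}$ means: whenever $X=P_0\cup P_1$, there are $i\in\{0,1\}$ and $Y'\subseteq P_i$ such that $Y'$ (with the subspace topology from $X$) is homeomorphic to $Y$. -}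

module Defs where

open import Axiom.ExcludedMiddle using (ExcludedMiddle)
open import Axiom.Extensionality.Propositional using (Extensionality)
open import Data.Bool.Base using (Bool; true; false; T; not; _∧_)
open import Data.Bool.Properties using (T-∧)
open import Data.Empty using (⊥-elim)
open import Data.Fin.Base using (Fin)
open import Data.Nat.Base using (ℕ)
open import Data.Product using (Σ; Σ-syntax; ∃; ∃-syntax; _×_; _,_; proj₁; proj₂)
open import Data.Sum.Base using (_⊎_; inj₁; inj₂)
open import Data.Unit.Base using (tt)
open import Function.Base using (_∘_; const; id)
open import Function.Bundles using (Func; Injection; Inverse; Equivalence; _↔_; _⇔_; mk⇔)
open import Function.Construct.Composition using (_↔-∘_; _⇔-∘_)
open import Function.Construct.Identity using (↔-id; ⇔-id)
open import Function.Construct.Symmetry using (↔-sym)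
open import Function.Definitions using (Injective)
open import Induction.WellFounded using (WellFounded)
open import Level using (Level; 0ℓ; _⊔_) renaming (suc to lsuc)
open import Relation.Binary.Bundles using (Setoid)
open import Relation.Binary.Core using (Rel)
open import Relation.Binary.Definitions using (_Respects_; tri<; tri≈; tri>)
open import Relation.Binary.PropositionalEquality
  using (_≡_; refl; sym; subst; subst₂; _→-setoid_)
import Relation.Binary.PropositionalEquality as ≡
import Relation.Binary.Construct.On as On
import Relation.Binary.Construct.Add.Supremum.Strict as Supremum
open import Relation.Binary.Structures using (IsStrictTotalOrder)
open import Relation.Nullary using (does; yes; no; ¬_)
open import Relation.Nullary.Construct.Add.Supremum using (_⁺; ⊤⁺; [_])
open import Relation.Unary using (Pred; _∈_; _∉_; _⊆_; _∩_; _≐_; U; ⋃; _⊢_)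

private variable
  a b ℓ₁ ℓ₂ o o′ : Level

------------------------------------------------------------------------
-- Classical foundations

-- Classical set theory is assumed in the form of the library's excluded middle
-- and function extensionality.  As Dec is not truncated, excluded middle
-- selects an element of every nonempty type; extensionality makes the selection
-- depend only on the subset selected from.  Together they give the axiom of
-- choice, here as canonical representatives of the classes of any setoid.
representatives :
  ExcludedMiddle 0ℓ → Extensionality 0ℓ 0ℓ → (S : Setoid 0ℓ 0ℓ) → let open Setoid S in
  Σ[ rep ∈ (Carrier → Carrier) ]
    (∀ x → x ≈ rep x) × (∀ {x y} → x ≈ y → rep x ≡ rep y)
representatives em ext S =
  (λ x → proj₁ (select (class x) (member x)))
  , (λ x → sound x _ (proj₂ (select (class x) (member x))))
  , λ x≈y → select-unique (class-cong x≈y) _ _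
  where
  module S = Setoid S
  open S using (Carrier; _≈_)

  select : (C : Carrier → Bool) → ∃ (T ∘ C) → ∃ (T ∘ C)
  select C c with em {∃ (T ∘ C)}
  ... | yes p = p
  ... | no ¬p = ⊥-elim (¬p c)

  select-unique : ∀ {C D} → C ≡ D → ∀ c d → proj₁ (select C c) ≡ proj₁ (select D d)
  select-unique {C} refl c d with em {∃ (T ∘ C)}
  ... | yes p = refl
  ... | no ¬p = ⊥-elim (¬p c)

  class : Carrier → Carrier → Bool
  class x y = does (em {x ≈ y})

  sound : ∀ x y → T (class x y) → x ≈ y
  sound x y t with em {x ≈ y}
  ... | yes x≈y = x≈y

  member : ∀ x → ∃ (T ∘ class x)
  member x = x , complete
    where
    complete : T (class x x)
    complete with em {x ≈ x}
    ... | yes _   = tt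
    ... | no x≉x = x≉x S.refl

  class-cong : ∀ {x y} → x ≈ y → class x ≡ class y
  class-cong {x} {y} x≈y = ext λ z → lemma z
    where
    lemma : ∀ z → class x z ≡ class y z
    lemma z with em {x ≈ z} | em {y ≈ z}
    ... | yes _   | yes _   = refl
    ... | no _    | no _    = refl
    ... | yes x≈z | no y≉z  = ⊥-elim (y≉z (S.trans (S.sym x≈y) x≈z))
    ... | no x≉z  | yes y≈z = ⊥-elim (x≉z (S.trans x≈y y≈z))

------------------------------------------------------------------------
-- Cardinality

infix 4 _≼_ _≺_

_≼_ : Setoid a ℓ₁ → Setoid b ℓ₂ → Set (a ⊔ b ⊔ ℓ₁ ⊔ ℓ₂)
A ≼ B = Injection A B

_≺_ : Setoid a ℓ₁ → Setoid b ℓ₂ → Set (a ⊔ b ⊔ ℓ₁ ⊔ ℓ₂)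
A ≺ B = (A ≼ B) × ¬ (B ≼ A)

-- Membership proofs are ignored by the equality.
subsetoid : (S : Setoid 0ℓ 0ℓ) → Pred (Setoid.Carrier S) 0ℓ → Setoid 0ℓ 0ℓ
subsetoid S A = On.setoid {B = ∃ A} S proj₁

ω : Setoid 0ℓ 0ℓ
ω = ≡.setoid ℕ

𝔠 : Setoid 0ℓ 0ℓ
𝔠 = ℕ →-setoid Bool

------------------------------------------------------------------------
-- Ordinals and cardinals

-- An ordinal is represented by a well-ordered set; its elements play the role
-- of the smaller ordinals.
record Ordinal : Set₁ where
  infix 4 _<_
  field
    Carrier            : Set
    _<_                : Rel Carrier 0ℓ
    isStrictTotalOrder : IsStrictTotalOrder _≡_ _<_
    wellFounded        : WellFounded _<_

  open IsStrictTotalOrder isStrictTotalOrder public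
    using (compare) renaming (trans to <-trans)

  setoid : Setoid 0ℓ 0ℓ
  setoid = ≡.setoid Carrier

infix 4 _≅ₒ_

_≅ₒ_ : Rel Ordinal 0ℓ
α ≅ₒ β = Σ[ f ∈ (A.Carrier ↔ B.Carrier) ]
           (∀ x y → x A.< y ⇔ Inverse.to f x B.< Inverse.to f y)
  where
  module A = Ordinal α
  module B = Ordinal β

≅ₒ-refl : ∀ {α} → α ≅ₒ α
≅ₒ-refl = ↔-id _ , λ _ _ → ⇔-id _

≅ₒ-sym : ∀ {α β} → α ≅ₒ β → β ≅ₒ α
≅ₒ-sym {α} {β} (f , mono) = ↔-sym f , λ x y → mk⇔
  (λ x<y → Equivalence.from (mono (from x) (from y))
    (subst₂ B._<_ (sym (to-from x)) (sym (to-from y)) x<y))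
  (λ fx<fy → subst₂ B._<_ (to-from x) (to-from y)
    (Equivalence.to (mono (from x) (from y)) fx<fy))
  where
  module B = Ordinal β
  open Inverse f using (to; from; strictlyInverseˡ)
  to-from : ∀ x → to (from x) ≡ x
  to-from = strictlyInverseˡ

≅ₒ-trans : ∀ {α β γ} → α ≅ₒ β → β ≅ₒ γ → α ≅ₒ γ
≅ₒ-trans (f , f-mono) (g , g-mono) =
  (g ↔-∘ f) , λ x y → g-mono (Inverse.to f x) (Inverse.to f y) ⇔-∘ f-mono x y

-- ω₁ as the set of all countable ordinals: well-ordered countable sets, with
-- order isomorphism as equality.
ω₁ : Setoid (lsuc 0ℓ) 0ℓ
ω₁ = record
  { Carrier       = Σ[ α ∈ Ordinal ] Ordinal.setoid α ≼ ω
  ; _≈_           = λ α β → proj₁ α ≅ₒ proj₁ β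
  ; isEquivalence = record
    { refl  = λ {α} → ≅ₒ-refl {proj₁ α}
    ; sym   = λ {α β} → ≅ₒ-sym {proj₁ α} {proj₁ β}
    ; trans = λ {α β γ} → ≅ₒ-trans {proj₁ α} {proj₁ β} {proj₁ γ}
    }
  }

-- Cardinals are initial ordinals: no injection into a proper initial segment.
record InfiniteCardinal : Set₁ where
  field
    ordinal : Ordinal
  open Ordinal ordinal public
  field
    initial  : ∀ α (f : Carrier → Carrier) → Injective _≡_ _≡_ f →
               ¬ (∀ x → f x < α)
    infinite : ω ≼ setoid

Cofinal : (κ : InfiniteCardinal) → Pred (Pred (InfiniteCardinal.Carrier κ) 0ℓ) 0ℓ
Cofinal κ A = ∀ α → ∃[ β ] β ∈ A × ¬ (β < α)
  where open InfiniteCardinal κ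

-- cf(κ) is the least cardinality of a cofinal subset, so cf(κ) > ω says that
-- every cofinal subset has cardinality > ω.
cf>ω : Pred InfiniteCardinal (lsuc 0ℓ)
cf>ω κ = ∀ A → Cofinal κ A → ω ≺ subsetoid (InfiniteCardinal.setoid κ) A

------------------------------------------------------------------------
-- Topological spaces

-- Points form a setoid, so that a subspace can have point–membership-proof
-- pairs as elements.  In the presence of excluded middle every predicate on a
-- small type is equivalent to a Bool-valued one; hence predicates in Set
-- exhaust all subsets, and index types in Set exhaust all families of them.
record Space (o : Level) : Set (lsuc (lsuc 0ℓ ⊔ o)) where
  field
    points : Setoid 0ℓ 0ℓ
  open Setoid points public using (Carrier; _≈_)
  field
    Open     : Pred (Pred Carrier 0ℓ) o
    open-≈   : ∀ {V} → Open V → V Respects _≈_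
    open-≐   : ∀ {V W} → V ≐ W → Open V → Open W
    open-U   : Open U
    open-∩   : ∀ {V W} → Open V → Open W → Open (V ∩ W)
    open-⋃   : ∀ {I : Set} (V : I → Pred Carrier 0ℓ) →
               (∀ i → Open (V i)) → Open (⋃ I V)

Continuous : (X : Space o) (Y : Space o′) →
             (Space.Carrier X → Space.Carrier Y) → Set (lsuc 0ℓ ⊔ o ⊔ o′)
Continuous X Y f = ∀ V → Space.Open Y V → Space.Open X (f ⊢ V)

record Homeomorphic (X : Space o) (Y : Space o′) : Set (lsuc 0ℓ ⊔ o ⊔ o′) where
  field
    bijection : Inverse (Space.points X) (Space.points Y)
  open Inverse bijection public using (to; from)
  field
    to-continuous   : Continuous X Y to
    from-continuous : Continuous Y X from

Subspace : (X : Space o) → Pred (Space.Carrier X) 0ℓ → Space (lsuc 0ℓ ⊔ o)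
Subspace X Y = record
  { points = subsetoid points Y
  ; Open   = λ W → ∃[ V ] Open V × (W ≐ (proj₁ ⊢ V))
  ; open-≈ = λ { (V , oV , W⊆V , V⊆W) x≈y Wx → V⊆W (open-≈ oV x≈y (W⊆V Wx)) }
  ; open-≐ = λ { (W⊆W′ , W′⊆W) (V , oV , W⊆V , V⊆W) →
                 V , oV , W⊆V ∘ W′⊆W , W⊆W′ ∘ V⊆W }
  ; open-U = U , open-U , id , id
  ; open-∩ = λ { (V , oV , W⊆V , V⊆W) (V′ , oV′ , W′⊆V′ , V′⊆W′) →
                 V ∩ V′ , open-∩ oV oV′
                 , (λ (w , w′) → W⊆V w , W′⊆V′ w′)
                 , (λ (v , v′) → V⊆W v , V′⊆W′ v′) }
  ; open-⋃ = λ W oW →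
      ⋃ _ (λ i → proj₁ (oW i)) , open-⋃ _ (λ i → proj₁ (proj₂ (oW i)))
      , (λ (i , w) → i , proj₁ (proj₂ (proj₂ (oW i))) w)
      , (λ (i , v) → i , proj₂ (proj₂ (proj₂ (oW i))) v)
  }
  where open Space X

-- The arrow relation X → (Y)¹₂.
infix 4 _⟶⟨_⟩¹₂

_⟶⟨_⟩¹₂ : Space o → Space o′ → Set (lsuc 0ℓ ⊔ o ⊔ o′)
X ⟶⟨ Y ⟩¹₂ =
  (P : Fin 2 → Pred Carrier 0ℓ) → (∀ i → P i Respects _≈_) →
  (∀ x → ∃[ i ] x ∈ P i) →
  ∃[ i ] Σ[ Y′ ∈ Pred Carrier 0ℓ ]
    Y′ Respects _≈_ × Y′ ⊆ P i × Homeomorphic (Subspace X Y′) Y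
  where open Space X

------------------------------------------------------------------------
-- β(ω) and ω*

-- Subsets of ω are characteristic functions.  Under excluded middle this loses
-- nothing, and it keeps the type of ultrafilters in Set.
record Ultrafilter : Set where
  field
    member     : (ℕ → Bool) → Bool
    full       : T (member (const true))
    proper     : ¬ T (member (const false))
    upward     : ∀ A B → (∀ n → T (A n) → T (B n)) → T (member A) → T (member B)
    intersect  : ∀ A B → T (member A) → T (member B) → T (member (λ n → A n ∧ B n))
    ultra      : ∀ A → T (member A) ⊎ T (member (not ∘ A))

open Ultrafilter using (member)

ultrafilters : Setoid 0ℓ 0ℓ
ultrafilters = On.setoid {B = Ultrafilter} ((ℕ → Bool) →-setoid Bool) member

-- The Stone–Čech compactification of discrete ω, as the space of ultrafilters
-- on ω; the sets { p ∣ A ∈ p } form a base.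
βω : Space 0ℓ
βω = record
  { points = ultrafilters
  ; Open   = λ V → ∀ p → p ∈ V →
               ∃[ A ] T (member p A) × (∀ q → T (member q A) → q ∈ V)
  ; open-≈ = λ oV {p} {q} p≈q Vp → let (A , A∈p , A⊆V) = oV p Vp in
               A⊆V q (subst T (p≈q A) A∈p)
  ; open-≐ = λ { (V⊆W , W⊆V) oV p Wp → let (A , A∈p , A⊆V) = oV p (W⊆V Wp) in
               A , A∈p , λ q → V⊆W ∘ A⊆V q }
  ; open-U = λ p _ → const true , Ultrafilter.full p , _
  ; open-∩ = λ oV oW p (Vp , Wp) →
      let (A , A∈p , A⊆V) = oV p Vp
          (B , B∈p , B⊆W) = oW p Wp
      in (λ n → A n ∧ B n) , Ultrafilter.intersect p A B A∈p B∈p , λ q A∧B∈q →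
           A⊆V q (Ultrafilter.upward q _ A
             (λ n → proj₁ ∘ Equivalence.to (T-∧ {A n} {B n})) A∧B∈q)
         , B⊆W q (Ultrafilter.upward q _ B
             (λ n → proj₂ ∘ Equivalence.to (T-∧ {A n} {B n})) A∧B∈q)
  ; open-⋃ = λ V oV p (i , Vip) → let (A , A∈p , A⊆V) = oV i p Vip in
               A , A∈p , λ q A∈q → i , A⊆V q A∈q
  }

-- The canonical embedding ω → β(ω).
principal : ℕ → Ultrafilter
principal n = record
  { member    = λ A → A n
  ; full      = tt
  ; proper    = id
  ; upward    = λ A B A⊆B → A⊆B n
  ; intersect = λ A B An Bn → Equivalence.from (T-∧ {A n} {B n}) (An , Bn)
  ; ultra     = λ A → decide (A n)
  }
  where
  decide : ∀ x → T x ⊎ T (not x)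
  decide true  = inj₁ tt
  decide false = inj₂ tt

ω* : Space (lsuc 0ℓ)
ω* = Subspace βω (λ p → ∀ n → ¬ (Space._≈_ βω p (principal n)))

------------------------------------------------------------------------
-- The space P_κ

-- The points are κ ⁺ = κ ∪ {⊤⁺}, with ⊤⁺ the point κ of κ + 1.  Excluded middle
-- is used only to check that unions of open sets are open.
P[_] : ExcludedMiddle 0ℓ → InfiniteCardinal → Space 0ℓ
P[ em ] κ = record
  { points = ≡.setoid (Carrier ⁺)
  ; Open   = IsOpen
  ; open-≈ = λ { _ refl v → v }
  ; open-≐ = λ { (_ , W⊆V) (inj₁ ∉V)        → inj₁ (∉V ∘ W⊆V)
               ; (V⊆W , _) (inj₂ (ξ , ξ⊆V)) → inj₂ (ξ , V⊆W ∘ ξ⊆V) }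
  ; open-U = inj₂ (Injection.to infinite 0 , _)
  ; open-∩ = open-∩
  ; open-⋃ = open-⋃
  }
  where
  open InfiniteCardinal κ
  open Supremum _<_ using (_<⁺_; <⁺-trans)

  ⟨_,κ] : Carrier → Pred (Carrier ⁺) 0ℓ
  ⟨ ξ ,κ] x = [ ξ ] <⁺ x

  IsOpen : Pred (Pred (Carrier ⁺) 0ℓ) 0ℓ
  IsOpen V = ⊤⁺ ∉ V ⊎ ∃[ ξ ] ⟨ ξ ,κ] ⊆ V

  shrink : ∀ {ξ ζ} → ξ < ζ → ⟨ ζ ,κ] ⊆ ⟨ ξ ,κ]
  shrink ξ<ζ = <⁺-trans <-trans Supremum.[ ξ<ζ ]

  open-∩ : ∀ {V W} → IsOpen V → IsOpen W → IsOpen (V ∩ W)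
  open-∩ (inj₁ ∉V) _ = inj₁ (∉V ∘ proj₁)
  open-∩ (inj₂ _) (inj₁ ∉W) = inj₁ (∉W ∘ proj₂)
  open-∩ (inj₂ (ξ , ξ⊆V)) (inj₂ (ζ , ζ⊆W)) with compare ξ ζ
  ... | tri< ξ<ζ _ _  = inj₂ (ζ , λ x → ξ⊆V (shrink ξ<ζ x) , ζ⊆W x)
  ... | tri≈ _ refl _ = inj₂ (ξ , λ x → ξ⊆V x , ζ⊆W x)
  ... | tri> _ _ ζ<ξ  = inj₂ (ξ , λ x → ξ⊆V x , ζ⊆W (shrink ζ<ξ x))

  open-⋃ : ∀ {I : Set} (V : I → Pred (Carrier ⁺) 0ℓ) →
           (∀ i → IsOpen (V i)) → IsOpen (⋃ I V)
  open-⋃ {I} V oV with em {⊤⁺ ∈ ⋃ I V}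
  ... | no ∉⋃ = inj₁ ∉⋃
  ... | yes (i , κ∈V) with oV i
  ...   | inj₁ ∉V        = ⊥-elim (∉V κ∈V)
  ...   | inj₂ (ξ , ξ⊆V) = inj₂ (ξ , λ x → i , ξ⊆V x)

{-# OPTIONS --safe #-}

-- Take an independent family A on ω with κ-many members and a filter F maximal
-- among those modulo which A stays independent.  Modulo F, the finite Boolean
-- combinations of A are dense, and since ω is countable every X ⊆ ω is
-- determined by countably many members of A (its support).  Hence an ultrafilter
-- u ⊇ F can be modified: for K ⊆ A there is v ⊇ F that agrees with u on all sets
-- supported by K and takes prescribed values on A ∖ K.  As cf(κ) > ω, supports
-- are bounded in κ, so modifications of p above α < κ converge to p as α → κ.
-- Iterating once gives p, points q α x (α < κ, x ≤ κ) with q α β → q α κ as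
-- β → κ, and q α (x α) → p as α → κ for every choice of x.  Either every row
-- q α meets the colour of p, and a choice of x gives a copy of P_κ, or some row
-- lies in the other colour and is itself a copy.
module Submission where

open import Defs
open import Axiom.ExcludedMiddle using (ExcludedMiddle)
open import Axiom.Extensionality.Propositional using (Extensionality)
open import Data.Bool.Base using (Bool; true; false; T; not; _∧_; if_then_else_)
open import Data.Bool.ListAction using (any)
import Data.Bool.Properties as Bool
open import Data.Bool.Properties using (T?; T-≡; T-not-≡; T-∧)
open import Data.Empty using (⊥; ⊥-elim)
open import Data.Fin.Base using (Fin; zero; suc)
open import Data.List.Base as List using (List; []; _∷_; _++_; applyUpTo)
open import Data.List.Membership.Propositional using (find; lose) renaming (_∈_ to _∈ˡ_)
open import Data.List.Membership.Propositional.Properties using (∈-++⁺ʳ)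
open import Data.List.Relation.Binary.Subset.Propositional using () renaming (_⊆_ to _⊆ˡ_)
open import Data.List.Relation.Unary.All as All using (All; []; _∷_)
open import Data.List.Relation.Unary.All.Properties using (++⁺; ++⁻ˡ; ++⁻ʳ; anti-mono; map⁻)
open import Data.List.Relation.Unary.Any using (here; there)
open import Data.List.Relation.Unary.Any.Properties using (any⁺; any⁻)
open import Data.Nat.Base using (ℕ; zero; suc; _*_; _≤_; _≤ᵇ_; _⊔_; z≤n; s≤s)
import Data.Nat.Binary.Base as ℕᵇ
open import Data.Nat.Binary.Base using (ℕᵇ; 2[1+_]; 1+[2_])
import Data.Nat.Binary.Properties as ℕᵇ
import Data.Nat.Properties as ℕ
open import Data.Product using (Σ-syntax; ∃; ∃-syntax; _×_; _,_; proj₁; proj₂)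
open import Data.Sum.Base using (_⊎_; inj₁; inj₂)
open import Data.Unit.Base using (⊤)
open import Function.Base using (_∘_; const; id; case_of_)
open import Function.Bundles using (Equivalence; Injection)
open import Level using (0ℓ)
open import Relation.Binary.Construct.Add.Supremum.Strict using ([_]; [_]<⊤⁺)
open import Relation.Binary.Definitions using (tri<; tri≈; tri>; _Respects_)
open import Relation.Binary.PropositionalEquality
  using (_≡_; _≗_; refl; sym; trans; cong; cong₂; subst)
open import Relation.Nullary using (yes; no; ¬_; does; isYes; decidable-stable)
open import Relation.Nullary.Construct.Add.Supremum using (_⁺; ⊤⁺; [_])
open import Relation.Nullary.Negation using (contradiction)
open import Relation.Unary using (Pred; _∈_; _∉_; _⊆_; _⊢_; ∅)

open Ultrafilter using (member)

-- Classical logic with Boolean truth values.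

module Classical (em : ExcludedMiddle 0ℓ) where

  ⟦_⟧ : Set → Bool
  ⟦ P ⟧ = isYes (em {P})

  ⟦⟧⁺ : ∀ {P} → P → T ⟦ P ⟧
  ⟦⟧⁺ {P} p with em {P}
  ... | yes _ = _
  ... | no ¬p = ¬p p

  ⟦⟧⁻ : ∀ {P} → T ⟦ P ⟧ → P
  ⟦⟧⁻ {P} t with em {P}
  ... | yes p = p

  ⟦⟧-true : ∀ {P} → P → ⟦ P ⟧ ≡ true
  ⟦⟧-true = Equivalence.to T-≡ ∘ ⟦⟧⁺

  ⟦⟧-false : ∀ {P} → ¬ P → ⟦ P ⟧ ≡ false
  ⟦⟧-false {P} ¬p with em {P}
  ... | yes p = contradiction p ¬p
  ... | no _  = refl

  by-contradiction : ∀ {P : Set} → ¬ ¬ P → P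
  by-contradiction = decidable-stable em

  ¬∀⇒∃¬ : ∀ {A : Set} {P : Pred A 0ℓ} → ¬ (∀ x → P x) → ∃[ x ] ¬ P x
  ¬∀⇒∃¬ ¬∀ = by-contradiction λ ¬∃ → ¬∀ λ x → by-contradiction λ ¬p → ¬∃ (x , ¬p)

  mix : {A : Set} {B : Set} → Pred A 0ℓ → (A → B) → (A → B) → A → B
  mix K f g x = if ⟦ K x ⟧ then f x else g x

  mix-∈ : ∀ {A B : Set} (K : Pred A 0ℓ) (f g : A → B) {x} → x ∈ K → mix K f g x ≡ f x
  mix-∈ K f g {x} x∈K rewrite ⟦⟧-true {K x} x∈K = refl

  mix-∉ : ∀ {A B : Set} (K : Pred A 0ℓ) (f g : A → B) {x} → x ∉ K → mix K f g x ≡ g x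
  mix-∉ K f g {x} x∉K rewrite ⟦⟧-false {K x} x∉K = refl

-- Maximal families of finite character.

-- The Teichmüller–Tukey lemma: adding one admissible element at a time produces
-- stages that form a chain (as in the Bourbaki–Witt theorem), and their union is
-- maximal.
module Tukey (em : ExcludedMiddle 0ℓ) (ext : Extensionality 0ℓ 0ℓ)
  (A : Set) (Good : Pred (List A) 0ℓ)
  (antitone : ∀ {l l′} → l ⊆ˡ l′ → Good l′ → Good l) (good-[] : Good [])
  where

  open Classical em

  Sub : Set
  Sub = A → Bool

  infix 4 _⊑_
  _⊑_ : Sub → Sub → Set
  S ⊑ R = ∀ x → T (S x) → T (R x)

  ⊑-trans : ∀ {S R Q} → S ⊑ R → R ⊑ Q → S ⊑ Q
  ⊑-trans S⊑R R⊑Q x = R⊑Q x ∘ S⊑R x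

  ⊑-antisym : ∀ {S R} → S ⊑ R → R ⊑ S → S ≡ R
  ⊑-antisym {S} {R} S⊑R R⊑S = ext λ x → lemma (S x) (R x) (S⊑R x) (R⊑S x)
    where
    lemma : ∀ b c → (T b → T c) → (T c → T b) → b ≡ c
    lemma true  true  _ _ = refl
    lemma false false _ _ = refl
    lemma true  false f _ = ⊥-elim (f _)
    lemma false true  _ g = ⊥-elim (g _)

  Admissible : Sub → Pred A 0ℓ
  Admissible S x = ¬ T (S x) × (∀ l → All (T ∘ S) l → Good (x ∷ l))

  -- The choice made by `em` is kept as a predicate: when nothing is admissible no element is
  -- chosen, and `next` adds nothing.
  Chosen : Sub → Pred A 0ℓ
  Chosen S y with em {∃ (Admissible S)}
  ... | yes (x , _) = y ≡ x
  ... | no _        = ⊥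

  chosen-exists : ∀ S → ∃ (Admissible S) → ∃ (Chosen S)
  chosen-exists S adm with em {∃ (Admissible S)}
  ... | yes (x , _) = x , refl
  ... | no ¬adm     = contradiction adm ¬adm

  chosen-admissible : ∀ S {y} → Chosen S y → Admissible S y
  chosen-admissible S y-chosen with em {∃ (Admissible S)}
  chosen-admissible S refl | yes (_ , adm) = adm

  chosen-unique : ∀ S {x y} → Chosen S x → Chosen S y → x ≡ y
  chosen-unique S x-chosen y-chosen with em {∃ (Admissible S)}
  chosen-unique S refl refl | yes _ = refl

  next : Sub → Sub
  next S x = ⟦ T (S x) ⊎ Chosen S x ⟧

  ⊑-next : ∀ S → S ⊑ next S
  ⊑-next S x = ⟦⟧⁺ ∘ inj₁

  ⋃ˢ : (Sub → Bool) → Sub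
  ⋃ˢ Q x = ⟦ (∃[ S ] T (Q S) × T (S x)) ⟧

  ⊑-⋃ˢ : ∀ Q {S} → T (Q S) → S ⊑ ⋃ˢ Q
  ⊑-⋃ˢ Q QS x x∈S = ⟦⟧⁺ (_ , QS , x∈S)

  ⋃ˢ-⊑ : ∀ Q {R} → (∀ S → T (Q S) → S ⊑ R) → ⋃ˢ Q ⊑ R
  ⋃ˢ-⊑ Q bound x x∈⋃ with ⟦⟧⁻ x∈⋃
  ... | S , QS , x∈S = bound S QS x x∈S

  -- `Q` is Boolean-valued so that `Stage` stays in `Set` and all stages can be collected into one
  -- `Q`. The empty `Q` yields the least stage.
  data Stage : Sub → Set where
    step  : ∀ {S} → Stage S → Stage (next S)
    limit : ∀ Q → (∀ S → T (Q S) → Stage S) → Stage (⋃ˢ Q)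

  -- These are the extreme points of the Bourbaki-Witt argument.
  Node : Pred Sub 0ℓ
  Node C = ∀ {R} → Stage R → R ⊑ C → ¬ (C ⊑ R) → next R ⊑ C

  -- Induction on `R`. At a successor, `Node C` applies unless `R` equals `C`, and then `next R` is
  -- `next C`. At a limit, either one member already contains `next C` or all lie below `C`.
  node-compare : ∀ {C R} → Node C → Stage R → R ⊑ C ⊎ next C ⊑ R
  node-compare {C} nodeC (step {R} stR) with node-compare nodeC stR
  ... | inj₂ nC⊑R = inj₂ (⊑-trans nC⊑R (⊑-next R))
  ... | inj₁ R⊑C with em {C ⊑ R}
  ...   | no C⋢R  = inj₁ (nodeC stR R⊑C C⋢R)
  ...   | yes C⊑R with ⊑-antisym R⊑C C⊑R
  ...     | refl = inj₂ λ _ → id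
  node-compare {C} nodeC (limit Q stQ) with em {∃[ S ] T (Q S) × next C ⊑ S}
  ... | yes (S , QS , nC⊑S) = inj₂ (⊑-trans nC⊑S (⊑-⋃ˢ Q QS))
  ... | no ¬above = inj₁ (⋃ˢ-⊑ Q below)
    where
    below : ∀ S → T (Q S) → S ⊑ C
    below S QS with node-compare nodeC (stQ S QS)
    ... | inj₁ S⊑C  = S⊑C
    ... | inj₂ nC⊑S = contradiction (S , QS , nC⊑S) ¬above

  -- Induction on `C`: compare `R` with the stage before the last step, or with a member of the
  -- union that is not contained in `R`.
  node : ∀ {C} → Stage C → Node C
  node (step {C} stC) stR R⊑nC nC⋢R with node-compare (node stC) stR
  ... | inj₂ nC⊑R = contradiction nC⊑R nC⋢R
  ... | inj₁ R⊑C with em {C ⊑ _}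
  ...   | no C⋢R  = ⊑-trans (node stC stR R⊑C C⋢R) (⊑-next C)
  ...   | yes C⊑R with ⊑-antisym R⊑C C⊑R
  ...     | refl = λ _ → id
  node (limit Q stQ) {R} stR R⊑⋃ ⋃⋢R = decide-stage
    (by-contradiction λ ¬∃ → ⋃⋢R
      (⋃ˢ-⊑ Q λ S QS → by-contradiction λ S⋢R → ¬∃ (S , QS , S⋢R)))
    where
    decide-stage : (∃[ S ] T (Q S) × ¬ (S ⊑ R)) → next R ⊑ ⋃ˢ Q
    decide-stage (S , QS , S⋢R) with node-compare (node (stQ S QS)) stR
    ... | inj₂ nS⊑R = contradiction (⊑-trans (⊑-next S) nS⊑R) S⋢R
    ... | inj₁ R⊑S  = ⊑-trans (node (stQ S QS) stR R⊑S S⋢R) (⊑-⋃ˢ Q QS)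

  chain : ∀ {C R} → Stage C → Stage R → R ⊑ C ⊎ C ⊑ R
  chain {C} stC stR with node-compare (node stC) stR
  ... | inj₁ R⊑C  = inj₁ R⊑C
  ... | inj₂ nC⊑R = inj₂ (⊑-trans (⊑-next C) nC⊑R)

  next-split : ∀ S {x} → Chosen S x → ∀ l → All (T ∘ next S) l →
               ∃[ l′ ] All (T ∘ S) l′ × l ⊆ˡ x ∷ l′
  next-split S x-chosen [] [] = [] , [] , λ ()
  next-split S x-chosen (y ∷ l) (y∈ ∷ l∈)
    with next-split S x-chosen l l∈ | ⟦⟧⁻ y∈
  ... | l′ , l′∈ , l⊆ | inj₁ y∈S = y ∷ l′ , y∈S ∷ l′∈ , λ
    { (here refl) → there (here refl)
    ; (there z∈) → case l⊆ z∈ of λ { (here z≡x) → here z≡x ; (there z∈l′) → there (there z∈l′) } }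
  ... | l′ , l′∈ , l⊆ | inj₂ y-chosen = l′ , l′∈ , λ
    { (here refl) → here (chosen-unique S y-chosen x-chosen)
    ; (there z∈)  → l⊆ z∈ }

  -- Stages form a chain, so the largest of the finitely many members involved contains the whole
  -- list. The list is nonempty because `Q` may be empty.
  ⋃ˢ-finite : ∀ Q → (∀ S → T (Q S) → Stage S) → ∀ x l → All (T ∘ ⋃ˢ Q) (x ∷ l) →
              ∃[ S ] T (Q S) × All (T ∘ S) (x ∷ l)
  ⋃ˢ-finite Q stQ x [] (x∈ ∷ []) with ⟦⟧⁻ x∈
  ... | S , QS , x∈S = S , QS , x∈S ∷ []
  ⋃ˢ-finite Q stQ x (y ∷ l) (x∈ ∷ l∈) with ⟦⟧⁻ x∈ | ⋃ˢ-finite Q stQ y l l∈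
  ... | S , QS , x∈S | R , QR , l∈R with chain (stQ S QS) (stQ R QR)
  ...   | inj₁ R⊑S = S , QS , x∈S ∷ All.map (R⊑S _) l∈R
  ...   | inj₂ S⊑R = R , QR , S⊑R x x∈S ∷ l∈R

  stage-consistent : ∀ {S} → Stage S → ∀ l → All (T ∘ S) l → Good l
  stage-consistent (step {S} stS) l l∈ with em {∃ (Chosen S)}
  ... | yes (x , x-chosen) =
    let (l′ , l′∈ , l⊆) = next-split S x-chosen l l∈ in
    antitone l⊆ (proj₂ (chosen-admissible S x-chosen) l′ l′∈)
  ... | no ¬chosen = stage-consistent stS l (All.map (back _) l∈)
    where
    back : next S ⊑ S
    back x x∈ with ⟦⟧⁻ x∈
    ... | inj₁ x∈S      = x∈S
    ... | inj₂ x-chosen = contradiction (_ , x-chosen) ¬chosen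
  stage-consistent (limit Q stQ) [] l∈ = good-[]
  stage-consistent (limit Q stQ) (x ∷ l) l∈ =
    let (S , QS , l∈S) = ⋃ˢ-finite Q stQ x l l∈ in stage-consistent (stQ S QS) (x ∷ l) l∈S

  maximal : Sub
  maximal = ⋃ˢ (λ S → ⟦ Stage S ⟧)

  maximal-stage : Stage maximal
  maximal-stage = limit _ λ S → ⟦⟧⁻

  maximal-consistent : ∀ l → All (T ∘ maximal) l → Good l
  maximal-consistent = stage-consistent maximal-stage

  -- As the largest stage, `maximal` contains its own `next`, hence the element that would be
  -- chosen.
  maximal-inadmissible : ∀ {x} → ¬ Admissible maximal x
  maximal-inadmissible adm =
    let (y , y-chosen) = chosen-exists maximal (_ , adm) in
    proj₁ (chosen-admissible maximal y-chosen)
      (⊑-⋃ˢ _ (⟦⟧⁺ (step maximal-stage)) y (⟦⟧⁺ (inj₂ y-chosen)))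

  maximal-omits : ∀ {x} → ¬ T (maximal x) → ∃[ l ] All (T ∘ maximal) l × ¬ Good (x ∷ l)
  maximal-omits x∉ = by-contradiction λ ¬∃ → maximal-inadmissible
    (x∉ , λ l l∈ → by-contradiction λ ¬good → ¬∃ (l , l∈ , ¬good))

-- Independent families of subsets of ω.

Matches : {I : Set} → (I → ℕ → Bool) → (I → Bool) → List I → ℕ → Set
Matches A z S n = All (λ i → A i n ≡ z i) S

-- The bound `m ≤ n` makes every finite Boolean combination infinite; this is what later keeps the
-- ultrafilters nonprincipal.
Independent : {I : Set} → (I → ℕ → Bool) → Set
Independent A = ∀ z S m → ∃[ n ] m ≤ n × Matches A z S n

interleave : (ℕ → Bool) → (ℕ → Bool) → ℕ → Bool
interleave x y zero    = x zero
interleave x y (suc n) = interleave y (x ∘ suc) n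

interleave-injective : ∀ {x y x′ y′} → interleave x y ≗ interleave x′ y′ → ∀ k →
                       x k ≡ x′ k × y k ≡ y′ k
interleave-injective eq zero    = eq 0 , eq 1
interleave-injective eq (suc k) = interleave-injective (λ n → eq (suc (suc n))) k

infix 4 _⊏_
_⊏_ : List Bool → (ℕ → Bool) → Bool
[]      ⊏ x = true
(b ∷ s) ⊏ x = does (b Bool.≟ x 0) ∧ (s ⊏ x ∘ suc)

applyUpTo-⊏ : ∀ x N → T (applyUpTo x N ⊏ x)
applyUpTo-⊏ x zero    = _
applyUpTo-⊏ x (suc N) with x 0 Bool.≟ x 0
... | yes _ = applyUpTo-⊏ (x ∘ suc) N
... | no ≢  = contradiction refl ≢

⊏-agree : ∀ x y N → T (applyUpTo x N ⊏ y) → ∀ {k} → suc k ≤ N → x k ≡ y k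
⊏-agree x y (suc N) x⊏y k<N with x 0 Bool.≟ y 0
⊏-agree x y (suc N) x⊏y {zero}  k<N       | yes eq = eq
⊏-agree x y (suc N) x⊏y {suc k} (s≤s k<N) | yes eq = ⊏-agree (x ∘ suc) (y ∘ suc) N x⊏y k<N

-- A natural number codes a finite list of binary strings: in bijective base two
-- an odd number opens a new string, and an even one extends the first string by
-- the bit given by the next digit.
extend : Bool → List (List Bool) → List (List Bool)
extend b []      = []
extend b (s ∷ w) = (b ∷ s) ∷ w

decode : ℕᵇ → List (List Bool)
decode ℕᵇ.zero         = []
decode 1+[2 n ]        = [] ∷ decode n
decode 2[1+ ℕᵇ.zero ]  = []
decode 2[1+ 1+[2 n ] ] = extend false (decode n)
decode 2[1+ 2[1+ n ] ] = extend true (decode n)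

encode-string : List Bool → ℕᵇ → ℕᵇ
encode-string []          n = 1+[2 n ]
encode-string (false ∷ s) n = 2[1+ 1+[2 encode-string s n ] ]
encode-string (true ∷ s)  n = 2[1+ 2[1+ encode-string s n ] ]

decode-string : ∀ s n → decode (encode-string s n) ≡ s ∷ decode n
decode-string []          n = refl
decode-string (false ∷ s) n = cong (extend false) (decode-string s n)
decode-string (true ∷ s)  n = cong (extend true) (decode-string s n)

n≤2n : ∀ {m n} → m ≤ n → m ≤ 2 * n
n≤2n m≤n = ℕ.m≤n⇒m≤n+o _ m≤n

toℕ-string : ∀ {m} s n → m ≤ ℕᵇ.toℕ n → m ≤ ℕᵇ.toℕ (encode-string s n)
toℕ-string []          n m≤n = ℕ.m≤n⇒m≤1+n (n≤2n m≤n)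
toℕ-string (false ∷ s) n m≤n = n≤2n (ℕ.m≤n⇒m≤1+n (ℕ.m≤n⇒m≤1+n (n≤2n (toℕ-string s n m≤n))))
toℕ-string (true ∷ s)  n m≤n = n≤2n (ℕ.m≤n⇒m≤1+n (n≤2n (ℕ.m≤n⇒m≤1+n (toℕ-string s n m≤n))))

-- Bits with no string to extend are discarded by `extend`, so these digits enlarge a code without
-- changing its list. Every list thus has arbitrarily large codes, as independence demands.
padding : ℕ → ℕᵇ
padding zero    = ℕᵇ.zero
padding (suc m) = 2[1+ 2[1+ padding m ] ]

decode-padding : ∀ m → decode (padding m) ≡ []
decode-padding zero    = refl
decode-padding (suc m) = cong (extend true) (decode-padding m)

toℕ-padding : ∀ m → m ≤ ℕᵇ.toℕ (padding m)
toℕ-padding zero    = z≤n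
toℕ-padding (suc m) = n≤2n (s≤s (n≤2n (ℕ.m≤n⇒m≤1+n (toℕ-padding m))))

decode-surjective : ∀ w m → ∃[ n ] m ≤ n × decode (ℕᵇ.fromℕ n) ≡ w
decode-surjective w m =
  ℕᵇ.toℕ (code w) , large w , trans (cong decode (ℕᵇ.fromℕ-toℕ (code w))) (decode-code w)
  where
  code : List (List Bool) → ℕᵇ
  code []      = padding m
  code (s ∷ w) = encode-string s (code w)

  large : ∀ w → m ≤ ℕᵇ.toℕ (code w)
  large []      = toℕ-padding m
  large (s ∷ w) = toℕ-string s (code w) (large w)

  decode-code : ∀ w → decode (code w) ≡ w
  decode-code []      = decode-padding m
  decode-code (s ∷ w) = trans (decode-string s (code w)) (cong (s ∷_) (decode-code w))

-- The classical independent family on the countable set of finite lists of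
-- binary strings: x yields the set of lists that contain an initial segment of x.
family : {I : Set} → (I → ℕ → Bool) → I → ℕ → Bool
family h i n = any (_⊏ h i) (decode (ℕᵇ.fromℕ n))

module _ (em : ExcludedMiddle 0ℓ) {I : Set} (h : I → ℕ → Bool)
  (h-injective : ∀ {i j} → h i ≗ h j → i ≡ j) where

  open Classical em

  separate : ∀ i S → ∃[ N ] All (λ j → T (applyUpTo (h i) N ⊏ h j) → i ≡ j) S
  separate i S = let (N , sep) = bound S in N , All.map (λ f → f N ℕ.≤-refl) sep
    where
    -- Quantifying over all longer `M` lets the bound survive the maximum with the next one.
    bound : ∀ S → ∃[ N ] All (λ j → ∀ M → N ≤ M → T (applyUpTo (h i) M ⊏ h j) → i ≡ j) S
    bound []      = 0 , []
    bound (j ∷ S) with bound S | em {h i ≗ h j}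
    ... | N , sep | yes eq = N , (λ _ _ _ → h-injective eq) ∷ sep
    ... | N , sep | no neq with ¬∀⇒∃¬ neq
    ...   | k , k-neq = suc k ⊔ N
      , (λ M le pre → contradiction
          (⊏-agree (h i) (h j) M pre (ℕ.≤-trans (ℕ.m≤m⊔n (suc k) N) le)) k-neq)
      ∷ All.map (λ f M le → f M (ℕ.≤-trans (ℕ.m≤n⊔m (suc k) N) le)) sep

  -- Take the list of long initial segments of those `h i`, `i` in `S`, with `z i` true. If `z i` is
  -- false, none of them is an initial segment of `h i`: the lengths are chosen so that this would
  -- identify two indices with different values of `z`.
  family-independent : Independent (family h)
  family-independent z S m =
    let (n , m≤n , eq) = decode-surjective (words S) m in
    n , m≤n , All.tabulate λ {i} i∈S →
      trans (cong (any (_⊏ h i)) eq) (value i∈S)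
    where
    word : I → List Bool
    word i = applyUpTo (h i) (proj₁ (separate i S))

    words : List I → List (List Bool)
    words []      = []
    words (i ∷ R) = if z i then word i ∷ words R else words R

    occurs : ∀ {i R} → i ∈ˡ R → z i ≡ true → word i ∈ˡ words R
    occurs {R = j ∷ R} (here refl) zi rewrite zi = here refl
    occurs {R = j ∷ R} (there i∈R) zi with z j
    ... | true  = there (occurs i∈R zi)
    ... | false = occurs i∈R zi

    origin : ∀ {s} R → s ∈ˡ words R → ∃[ j ] z j ≡ true × s ≡ word j
    origin (j ∷ R) s∈ with z j in zj
    origin (j ∷ R) (here refl) | true  = j , zj , refl
    origin (j ∷ R) (there s∈)  | true  = origin R s∈
    origin (j ∷ R) s∈          | false = origin R s∈

    value : ∀ {i} → i ∈ˡ S → any (_⊏ h i) (words S) ≡ z i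
    value {i} i∈S with z i in zi
    ... | true = Equivalence.to T-≡
      (any⁺ _ (lose (occurs i∈S zi) (applyUpTo-⊏ (h i) (proj₁ (separate i S)))))
    ... | false with any (_⊏ h i) (words S) in eq
    ...   | false = refl
    ...   | true with find (any⁻ (_⊏ h i) (words S) (Equivalence.from T-≡ eq))
    ...     | s , s∈ , s⊏ with origin S s∈
    ...       | j , zj , refl with All.lookup (proj₂ (separate j S)) i∈S s⊏
    ...         | refl = trans (sym zj) zi

-- Ultrafilters on ω.

infix 4 _∈⋂_
_∈⋂_ : ℕ → List (ℕ → Bool) → Set
n ∈⋂ l = All (λ X → T (X n)) l

∁ : (ℕ → Bool) → ℕ → Bool
∁ X = not ∘ X

T-not : ∀ {b} → ¬ T b → T (not b)
T-not {false} _  = _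
T-not {true}  ¬t = ¬t _

not-T : ∀ {b} → T (not b) → ¬ T b
not-T {false} _ ()

module _ (em : ExcludedMiddle 0ℓ) (ext : Extensionality 0ℓ 0ℓ) where

  open Classical em

  -- Tukey's lemma starts from the empty family; since `Good` demands compatibility with `G`, the
  -- maximal family absorbs all of `G`.
  ultrafilter-extending : (G : Pred (ℕ → Bool) 0ℓ) → (∀ l → All G l → ∃[ n ] n ∈⋂ l) →
                          ∃[ u ] (∀ {X} → X ∈ G → T (member u X))
  ultrafilter-extending G fip = u , G⊆M
    where
    Good : Pred (List (ℕ → Bool)) 0ℓ
    Good l = ∀ g → All G g → ∃[ n ] n ∈⋂ l × n ∈⋂ g

    antitone : ∀ {l l′} → l ⊆ˡ l′ → Good l′ → Good l
    antitone l⊆l′ good g g⊆G =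
      let (n , n∈l′ , n∈g) = good g g⊆G in n , anti-mono l⊆l′ n∈l′ , n∈g

    good-[] : Good []
    good-[] g g⊆G = let (n , n∈g) = fip g g⊆G in n , [] , n∈g

    open Tukey em ext (ℕ → Bool) Good antitone good-[]
      using (maximal-consistent; maximal-omits) renaming (maximal to M)

    G⊆M : ∀ {X} → X ∈ G → T (M X)
    G⊆M {X} X∈G = by-contradiction λ X∉M →
      let (l , l⊆M , bad) = maximal-omits X∉M in
      -- Counting `X` among the members of `G` reduces goodness of `X ∷ l` to that of `l`.
      bad λ g g⊆G → case maximal-consistent l l⊆M (X ∷ g) (X∈G ∷ g⊆G) of λ
        { (n , n∈l , n∈X ∷ n∈g) → n , n∈X ∷ n∈l , n∈g }

    closed : ∀ l {X} → All (T ∘ M) l → (∀ n → n ∈⋂ l → T (X n)) → T (M X)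
    closed l l⊆M ⋂l⊆X = by-contradiction λ X∉M →
      let (l′ , l′⊆M , bad) = maximal-omits X∉M in
      bad λ g g⊆G →
        let (n , n∈ , n∈g) = maximal-consistent (l ++ l′) (++⁺ l⊆M l′⊆M) g g⊆G in
        n , ⋂l⊆X n (++⁻ˡ l n∈) ∷ ++⁻ʳ l n∈ , n∈g

    -- The failure of goodness is witnessed by finitely many members of `G`; they belong to `M` and
    -- can be joined to the list.
    omit : ∀ {X} → ¬ T (M X) → ∃[ l ] All (T ∘ M) l × (∀ n → n ∈⋂ l → ¬ T (X n))
    omit X∉M = by-contradiction λ ¬∃ →
      let (l , l⊆M , bad) = maximal-omits X∉M in
      bad λ g g⊆G → by-contradiction λ empty →
        ¬∃ (l ++ g , ++⁺ l⊆M (All.map G⊆M g⊆G)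
           , λ n n∈ n∈X → empty (n , n∈X ∷ ++⁻ˡ l n∈ , ++⁻ʳ l n∈))

    u : Ultrafilter
    u = record
      { member    = M
      ; full      = closed [] [] _
      ; proper    = λ ∅∈M → case maximal-consistent _ (∅∈M ∷ []) [] [] of λ
          { (n , () ∷ _ , _) }
      ; upward    = λ A B A⊆B A∈M → closed (A ∷ []) (A∈M ∷ []) λ { n (n∈A ∷ []) → A⊆B n n∈A }
      ; intersect = λ A B A∈M B∈M → closed (A ∷ B ∷ []) (A∈M ∷ B∈M ∷ []) λ
          { n (n∈A ∷ n∈B ∷ []) → Equivalence.from T-∧ (n∈A , n∈B) }
      ; ultra     = λ A → case T? (M A) of λ
          { (yes A∈M) → inj₁ A∈M
          ; (no A∉M)  → let (l , l⊆M , ⋂l∩A) = omit A∉M in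
                        inj₂ (closed l l⊆M λ n n∈l → T-not (⋂l∩A n n∈l)) }
      }

module _ (u : Ultrafilter) where
  open Ultrafilter u hiding (member)

  member-disjoint : ∀ {X} → T (member u X) → ¬ T (member u (∁ X))
  member-disjoint {X} X∈u ∁X∈u = proper (upward _ _ absurd (intersect X (∁ X) X∈u ∁X∈u))
    where
    absurd : ∀ n → T (X n ∧ not (X n)) → ⊥
    absurd n with X n
    ... | true  = id
    ... | false = id

  member-⋂ : ∀ l → All (T ∘ member u) l →
             ∃[ W ] T (member u W) × (∀ n → T (W n) → n ∈⋂ l)
  member-⋂ []      []          = const true , full , λ _ _ → []
  member-⋂ (X ∷ l) (X∈u ∷ l⊆u) =
    let (W , W∈u , W⊆⋂l) = member-⋂ l l⊆u in
    (λ n → X n ∧ W n) , intersect X W X∈u W∈u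
    , λ n n∈ → let (n∈X , n∈W) = Equivalence.to T-∧ n∈ in n∈X ∷ W⊆⋂l n n∈W

-- Forcing with finite conditions modulo a maximal filter.

module Forcing (em : ExcludedMiddle 0ℓ) (ext : Extensionality 0ℓ 0ℓ)
  {I : Set} (A : I → ℕ → Bool) (independent : Independent A)
  where

  open Classical em

  private
    -- `A` remains independent when restricted to the intersection of `l`.
    Good : Pred (List (ℕ → Bool)) 0ℓ
    Good l = ∀ z S m → ∃[ n ] m ≤ n × Matches A z S n × n ∈⋂ l

    antitone : ∀ {l l′} → l ⊆ˡ l′ → Good l′ → Good l
    antitone l⊆l′ good z S m =
      let (n , m≤n , n∈S , n∈l′) = good z S m in n , m≤n , n∈S , anti-mono l⊆l′ n∈l′

    good-[] : Good []
    good-[] z S m = let (n , m≤n , n∈S) = independent z S m in n , m≤n , n∈S , []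

  open Tukey em ext (ℕ → Bool) Good antitone good-[] public using ()
    renaming (maximal to F; maximal-consistent to F-consistent; maximal-omits to F-omits)

  -- Goodness already asks for arbitrarily large points, so the larger of the two bounds serves
  -- both.
  final∈F : ∀ m → T (F (m ≤ᵇ_))
  final∈F m = by-contradiction λ ∉F →
    let (l , l⊆F , bad) = F-omits ∉F in
    bad λ z S k →
      let (n , le , n∈S , n∈l) = F-consistent l l⊆F z S (m ⊔ k) in
      n , ℕ.≤-trans (ℕ.m≤n⊔m m k) le , n∈S
      , ℕ.≤⇒≤ᵇ (ℕ.≤-trans (ℕ.m≤m⊔n m k) le) ∷ n∈l

  -- A condition (z , S) is the finite partial function z ↾ S.
  infix 4 _,_⊩_
  _,_⊩_ : (I → Bool) → List I → Pred (ℕ → Bool) 0ℓ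
  z , S ⊩ X = ∃[ l ] All (T ∘ F) l × (∀ n → n ∈⋂ l → Matches A z S n → T (X n))

  trace : ℕ → I → Bool
  trace n i = A i n

  -- Some `n` realises the common extension `y` and lies in both lists from `F`; it would belong to
  -- both `X` and `∁ X`.
  ⊩-incompatible : ∀ {z S z′ S′ X} → z , S ⊩ X → z′ , S′ ⊩ ∁ X →
                   ∀ y → All (λ i → y i ≡ z i) S → All (λ i → y i ≡ z′ i) S′ → ⊥
  ⊩-incompatible {z} {S} {z′} {S′} (l , l⊆F , forces) (l′ , l′⊆F , forces′) y y≡z y≡z′ =
    let (n , _ , n∈ , n∈ll′) = F-consistent (l ++ l′) (++⁺ l⊆F l′⊆F) y (S ++ S′) 0 in
    not-T (forces′ n (++⁻ʳ l n∈ll′) (transfer y≡z′ (++⁻ʳ S n∈)))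
          (forces n (++⁻ˡ l n∈ll′) (transfer y≡z (++⁻ˡ S n∈)))
    where
    transfer : ∀ {w R n} → All (λ i → y i ≡ w i) R → Matches A y R n → Matches A w R n
    transfer eqs ms = All.zipWith (λ (eq , m) → trans m eq) (eqs , ms)

  -- By maximality of F the conditions deciding X are dense; the extension of
  -- (z , S) that forces ∁ X can be read off a single n.
  decide : ∀ z S X → z , S ⊩ X ⊎
           ∃[ n ] Matches A z S n × ∃[ R ] S ⊆ˡ R × trace n , R ⊩ ∁ X
  decide z S X = case T? (F Y) of λ
    { (yes Y∈F) → inj₁ (Y ∷ [] , Y∈F ∷ [] , λ { n (n∈Y ∷ []) → ⟦⟧⁻ n∈Y })
    ; (no Y∉F)  → inj₂ (refute Y∉F) }
    where
    -- If `Y` is not in `F`, there are `l`, `z′`, `S′` and `m` such that every `n ≥ m` in the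
    -- intersection of `l` that matches `z′` on `S′` lies outside `Y`, so it matches `z` on `S` and
    -- misses `X`. The trace of any such `n` serves.
    Y : ℕ → Bool
    Y n = ⟦ (Matches A z S n → T (X n)) ⟧

    refute : ¬ T (F Y) → ∃[ n ] Matches A z S n × ∃[ R ] S ⊆ˡ R × trace n , R ⊩ ∁ X
    refute Y∉F =
      let (l , l⊆F , bad)            = F-omits Y∉F
          (z′ , bad′)                = ¬∀⇒∃¬ bad
          (S′ , bad″)                = ¬∀⇒∃¬ bad′
          (m , empty)                = ¬∀⇒∃¬ bad″
          (n , m≤n , n∈S′ , n∈l)     = F-consistent l l⊆F z′ S′ m
          n∉Y : ¬ (Matches A z S n → T (X n))
          n∉Y n∈Y                    = empty (n , m≤n , n∈S′ , ⟦⟧⁺ n∈Y ∷ n∈l)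
      in n , by-contradiction (λ n∉S → n∉Y λ n∈S → contradiction n∈S n∉S)
         , S′ ++ S , ∈-++⁺ʳ S′
         , (m ≤ᵇ_) ∷ l , final∈F m ∷ l⊆F
         , λ { k (m≤k ∷ k∈l) k∈ → T-not λ k∈X → empty
               (k , ℕ.≤ᵇ⇒≤ m k m≤k
                  , All.zipWith (λ (eq , eq′) → trans eq eq′) (++⁻ˡ S′ k∈ , n∈S′)
                  , ⟦⟧⁺ (const k∈X) ∷ k∈l) }

  -- The forcing form of the statement that, modulo `F`, `X` depends only on the members of `A`
  -- indexed by `K`.
  Supported : Pred I 0ℓ → Pred (ℕ → Bool) 0ℓ
  Supported K X = ∀ z z′ S → (∀ {i} → i ∈ K → z i ≡ z′ i) → z , S ⊩ X → z′ , S ⊩ X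

  -- The conditions realised by a given n are pairwise compatible, so one deciding
  -- condition for each n is enough to form a predense set.
  countable-support : ∀ X → Σ[ R ∈ (ℕ → List I) ]
                      (∀ K → (∀ n → All K (R n)) → Supported K X)
  countable-support X = R , supported
    where
    Decides : ℕ → List I → Set
    Decides n R = trace n , R ⊩ X ⊎ trace n , R ⊩ ∁ X

    R : ℕ → List I
    R n with em {∃ (Decides n)}
    ... | yes (R , _) = R
    -- Harmless default: `R n` is consulted only when some finite part of the trace of `n` decides
    -- `X`.
    ... | no _        = []

    R-decides : ∀ n → ∃ (Decides n) → Decides n (R n)
    R-decides n ∃R with em {∃ (Decides n)}
    ... | yes (_ , dec) = dec
    ... | no ∄R         = contradiction ∃R ∄R

    supported : ∀ K → (∀ n → All K (R n)) → Supported K X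
    supported K R⊆K z z′ S agree z⊩X with decide z′ S X
    ... | inj₁ z′⊩X = z′⊩X
    ... | inj₂ (n , n∈S , Q , S⊆Q , n⊩∁X) with R-decides n (Q , inj₂ n⊩∁X)
    ...   | inj₁ n⊩X = ⊥-elim
      (⊩-incompatible n⊩X n⊩∁X (trace n) (All.tabulate λ _ → refl) (All.tabulate λ _ → refl))
    ...   | inj₂ R⊩∁X = ⊥-elim (⊩-incompatible z⊩X R⊩∁X y (All.map z-agrees n∈S)
      (All.map (mix-∈ K (trace n) z) (R⊆K n)))
      where
      -- A common extension of `z` on `S` and the trace of `n` on `R n`: the two can only meet
      -- inside `K`, where `z` agrees with `z′` and hence, on `S`, with the trace.
      y : I → Bool
      y = mix K (trace n) z
      z-agrees : ∀ {i} → A i n ≡ z′ i → y i ≡ z i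
      z-agrees {i} eq with em {K i}
      ... | yes i∈K = trans eq (sym (agree i∈K))
      ... | no i∉K  = refl

  literal : I → Bool → ℕ → Bool
  literal i true  = A i
  literal i false = ∁ (A i)

  literal⁺ : ∀ {i n} b → A i n ≡ b → T (literal i b n)
  literal⁺ true  = Equivalence.from T-≡
  literal⁺ false = Equivalence.from T-not-≡

  literal⁻ : ∀ {i n} b → T (literal i b n) → A i n ≡ b
  literal⁻ true  = Equivalence.to T-≡
  literal⁻ false = Equivalence.to T-not-≡

  -- A condition forcing a literal of `i` must have `i` in its domain, for otherwise it could be
  -- extended by the opposite value at `i`. The value there is then `b` and is shared by `z′`.
  literal-supported : ∀ {K i} b → i ∈ K → Supported K (literal i b)
  literal-supported {K} {i} b i∈K z z′ S agree (l , l⊆F , forces) with em {i ∈ˡ S}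
  ... | yes i∈S =
    let (n , _ , n∈S , n∈l) = F-consistent l l⊆F z S 0
        zi≡b = trans (sym (All.lookup n∈S i∈S)) (literal⁻ b (forces n n∈l n∈S))
    in [] , [] , λ k _ k∈S → literal⁺ b
         (trans (All.lookup k∈S i∈S) (trans (sym (agree i∈K)) zi≡b))
  ... | no i∉S = ⊥-elim (clash (F-consistent l l⊆F y (i ∷ S) 0))
    where
    y : I → Bool
    y = mix (_≡ i) (const (not b)) z
    clash : ¬ (∃[ n ] 0 ≤ n × Matches A y (i ∷ S) n × n ∈⋂ l)
    clash (n , _ , n∈i ∷ n∈S , n∈l) = Bool.not-¬
      (literal⁻ b (forces n n∈l (All.tabulate λ {j} j∈S → trans (All.lookup n∈S j∈S)
        (mix-∉ (_≡ i) (const (not b)) z λ { refl → i∉S j∈S }))))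
      (trans n∈i (mix-∈ (_≡ i) (const (not b)) z refl))

  Extends-F : Pred Ultrafilter 0ℓ
  Extends-F u = ∀ {X} → T (F X) → T (member u X)

  F-supported : ∀ {K X} → T (F X) → Supported K X
  F-supported {X = X} X∈F z z′ S _ _ = X ∷ [] , X∈F ∷ [] , λ { n (n∈X ∷ []) _ → n∈X }

  member-literal : ∀ u {i} b → T (member u (literal i b)) → member u (A i) ≡ b
  member-literal u true  t = Equivalence.to T-≡ t
  member-literal u {i} false t with member u (A i) in eq
  ... | false = refl
  ... | true  = contradiction t (member-disjoint u (Equivalence.from T-≡ eq))

  literal-member : ∀ u {i} b → member u (A i) ≡ b → T (member u (literal i b))
  literal-member u true  eq = Equivalence.from T-≡ eq
  literal-member u {i} false eq with Ultrafilter.ultra u (A i)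
  ... | inj₂ t = t
  ... | inj₁ t = contradiction (trans (sym (Equivalence.to T-≡ t)) eq) λ ()

  record Modification (u : Ultrafilter) (K : Pred I 0ℓ) (ε : I → Bool) : Set where
    field
      result    : Ultrafilter
      extends-F : Extends-F result
      inside    : ∀ {X} → Supported K X → T (member u X) → T (member result X)
      outside   : ∀ i → i ∉ K → member result (A i) ≡ ε i

    inside-index : ∀ i → i ∈ K → member result (A i) ≡ member u (A i)
    inside-index i i∈K = member-literal result (member u (A i))
      (inside (literal-supported (member u (A i)) i∈K) (literal-member u (member u (A i)) refl))

  abstract
    -- The sets of `u` supported by `K` and the prescribed literals off `K` have the finite
    -- intersection property: a condition forcing finitely many of the former still forces them
    -- after its values off `K` are changed to `ε`.
    modify : ∀ u → Extends-F u → ∀ K ε → Modification u K ε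
    modify u F⊆u K ε = record
      { result    = v
      ; extends-F = λ X∈F → G⊆v (inj₁ (F⊆u X∈F , F-supported X∈F))
      ; inside    = λ sup X∈u → G⊆v (inj₁ (X∈u , sup))
      ; outside   = λ i i∉K → member-literal v (ε i) (G⊆v (inj₂ (i , i∉K , refl)))
      }
      where
      G : Pred (ℕ → Bool) 0ℓ
      G X = (T (member u X) × Supported K X) ⊎ ∃[ i ] i ∉ K × X ≡ literal i (ε i)

      split : ∀ l → All G l →
              ∃[ Xs ] ∃[ S ] All (λ X → T (member u X) × Supported K X) Xs × All (_∉ K) S ×
                (∀ n → n ∈⋂ Xs → Matches A ε S n → n ∈⋂ l)
      split [] [] = [] , [] , [] , [] , λ _ _ _ → []
      split (X ∷ l) (g ∷ gs) with split l gs
      split (X ∷ l) (inj₁ X∈ ∷ gs) | Xs , S , Xs∈ , S∉ , f =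
        X ∷ Xs , S , X∈ ∷ Xs∈ , S∉ , λ { n (n∈X ∷ n∈) n∈S → n∈X ∷ f n n∈ n∈S }
      split (X ∷ l) (inj₂ (i , i∉K , refl) ∷ gs) | Xs , S , Xs∈ , S∉ , f =
        Xs , i ∷ S , Xs∈ , i∉K ∷ S∉ , λ { n n∈ (n∈i ∷ n∈S) → literal⁺ (ε i) n∈i ∷ f n n∈ n∈S }

      -- The empty condition cannot force `∁ W`, which would then belong to `u` because `u` extends
      -- `F`. So `decide` finds a condition forcing the double complement.
      forced-below : ∀ W → T (member u W) → ∃[ z ] ∃[ S ] z , S ⊩ W
      forced-below W W∈u with decide ε [] (∁ W)
      ... | inj₁ (l , l⊆F , forces) =
        let (V , V∈u , V⊆⋂l) = member-⋂ u l (All.map F⊆u l⊆F) in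
        contradiction (Ultrafilter.upward u V (∁ W) (λ n n∈V → forces n (V⊆⋂l n n∈V) []) V∈u)
                      (member-disjoint u W∈u)
      ... | inj₂ (n , _ , R , _ , l , l⊆F , forces) =
        trace n , R , l , l⊆F , λ k k∈l k∈R → double-not (forces k k∈l k∈R)
        where
        double-not : ∀ {b} → T (not (not b)) → T b
        double-not {true} _ = _

      ⊩-⋂ : ∀ {z S} Xs → All (λ X → z , S ⊩ X) Xs →
            ∃[ l ] All (T ∘ F) l × (∀ n → n ∈⋂ l → Matches A z S n → n ∈⋂ Xs)
      ⊩-⋂ [] [] = [] , [] , λ _ _ _ → []
      ⊩-⋂ (X ∷ Xs) ((l , l⊆F , f) ∷ fs) =
        let (l′ , l′⊆F , f′) = ⊩-⋂ Xs fs in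
        l ++ l′ , ++⁺ l⊆F l′⊆F
        , λ n n∈ n∈S → f n (++⁻ˡ l n∈) n∈S ∷ f′ n (++⁻ʳ l n∈) n∈S

      fip : ∀ l → All G l → ∃[ n ] n ∈⋂ l
      fip l gs =
        let (Xs , S′ , Xs∈ , S′∉ , f) = split l gs
            (W , W∈u , W⊆⋂) = member-⋂ u Xs (All.map proj₁ Xs∈)
            (z , S , l₀ , l₀⊆F , forces) = forced-below W W∈u
            -- The supports keep all of `Xs` forced under `y`, which now also agrees with the
            -- literals on `S′`.
            y = mix K z ε
            all-forced = All.tabulate λ {X} X∈Xs → proj₂ (All.lookup Xs∈ X∈Xs) z y S
              (λ i∈K → sym (mix-∈ K z ε i∈K))
              (l₀ , l₀⊆F , λ n n∈l₀ n∈S → All.lookup (W⊆⋂ n (forces n n∈l₀ n∈S)) X∈Xs)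
            (l₁ , l₁⊆F , f₁) = ⊩-⋂ {y} {S} Xs all-forced
            (n , _ , n∈ , n∈l₁) = F-consistent l₁ l₁⊆F y (S ++ S′) 0
        in n , f n (f₁ n n∈l₁ (++⁻ˡ S n∈))
             (All.zipWith (λ (i∉K , eq) → trans eq (mix-∉ K z ε i∉K)) (S′∉ , ++⁻ʳ S n∈))

      extension : ∃[ v ] (∀ {X} → X ∈ G → T (member v X))
      extension = ultrafilter-extending em ext G fip
      v : Ultrafilter
      v = proj₁ extension
      G⊆v : ∀ {X} → X ∈ G → T (member v X)
      G⊆v = proj₂ extension

    F-ultrafilter : ∃ Extends-F
    F-ultrafilter = ultrafilter-extending em ext (T ∘ F) λ l l⊆F →
      let (n , _ , _ , n∈l) = F-consistent l l⊆F (const true) [] 0 in n , n∈l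

    nonprincipal : ∀ {u} → Extends-F u → ∀ n → ¬ member u ≗ member (principal n)
    nonprincipal F⊆u n eq = ℕ.<-irrefl refl
      (ℕ.≤ᵇ⇒≤ (suc n) n (subst T (eq (suc n ≤ᵇ_)) (F⊆u (final∈F (suc n)))))

-- Copies of `P[ em ] κ` in `ω*`.

module Convergence (em : ExcludedMiddle 0ℓ) (κ : InfiniteCardinal) where

  open InfiniteCardinal κ
  open Classical em

  <-irrefl : ∀ {α} → ¬ α < α
  <-irrefl {α} α<α with compare α α
  ... | tri< _ α≢α _ = α≢α refl
  ... | tri≈ α≮α _ _ = α≮α α<α
  ... | tri> _ α≢α _ = α≢α refl

  -- For the point at position α: the set labelled (γ , true) separates the points
  -- above γ from the others, and the set labelled (γ , false) isolates the point γ.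
  mark : Carrier → Carrier → Bool → Bool
  mark α γ true  = ⟦ γ < α ⟧
  mark α γ false = ⟦ γ ≡ α ⟧

  mark-below : ∀ {α γ} → γ < α → ∀ b → mark α γ b ≡ b
  mark-below γ<α true  = ⟦⟧-true γ<α
  mark-below γ<α false = ⟦⟧-false λ { refl → <-irrefl γ<α }

  -- The labels make `s` injective with continuous inverse on its range; `converges` makes `s`
  -- continuous at the limit point.
  record Convergent (s : Carrier ⁺ → Ultrafilter) : Set where
    field
      nonprincipal : ∀ x n → ¬ member (s x) ≗ member (principal n)
      label        : Carrier → Bool → ℕ → Bool
      label-point  : ∀ α γ b → member (s [ α ]) (label γ b) ≡ mark α γ b
      label-limit  : ∀ γ b → member (s ⊤⁺) (label γ b) ≡ b
      converges    : ∀ {X} → T (member (s ⊤⁺) X) →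
                     ∃[ ξ ] (∀ α → ξ < α → T (member (s [ α ]) X))

    injective : ∀ x y → member (s x) ≗ member (s y) → x ≡ y
    injective ⊤⁺    ⊤⁺    eq = refl
    injective [ α ] [ β ] eq = cong [_] (⟦⟧⁻ (Equivalence.from T-≡
      (trans (sym (label-point β α false))
        (trans (sym (eq _)) (trans (label-point α α false) (⟦⟧-true refl))))))
    injective ⊤⁺ [ β ] eq = contradiction
      (trans (sym (label-limit β false))
        (trans (eq _) (trans (label-point β β false) (⟦⟧-true refl)))) λ ()
    injective [ α ] ⊤⁺ eq = contradiction
      (trans (sym (label-limit α false))
        (trans (sym (eq _)) (trans (label-point α α false) (⟦⟧-true refl)))) λ ()

    point : Carrier ⁺ → Space.Carrier ω*
    point x = s x , nonprincipal x

    Range : Pred (Space.Carrier ω*) 0ℓ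
    Range y = ∃[ x ] Space._≈_ ω* y (point x)

    Range-respects : Range Respects (Space._≈_ ω*)
    Range-respects y≈y′ (x , y≈x) = x , λ X → trans (sym (y≈y′ X)) (y≈x X)

    separated : ∀ V → Space.Open (P[ em ] κ) V → ∀ x → x ∈ V →
                ∃[ X ] T (member (s x) X) × (∀ y → T (member (s y) X) → y ∈ V)
    separated V oV [ α ] α∈V =
      label α false , Equivalence.from T-≡ (trans (label-point α α false) (⟦⟧-true refl)) , only
      where
      only : ∀ y → T (member (s y) (label α false)) → y ∈ V
      only ⊤⁺    t = ⊥-elim (subst T (label-limit α false) t)
      only [ β ] t with ⟦⟧⁻ (subst T (label-point β α false) t)
      ... | refl = α∈V
    separated V (inj₁ ⊤∉V) ⊤⁺ ⊤∈V = contradiction ⊤∈V ⊤∉V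
    separated V (inj₂ (ξ , tail⊆V)) ⊤⁺ ⊤∈V =
      label ξ true , Equivalence.from T-≡ (label-limit ξ true) , above
      where
      above : ∀ y → T (member (s y) (label ξ true)) → y ∈ V
      above ⊤⁺    t = ⊤∈V
      above [ β ] t = tail⊆V [ ⟦⟧⁻ (subst T (label-point β ξ true) t) ]

    homeomorphic : Homeomorphic (Subspace ω* Range) (P[ em ] κ)
    homeomorphic = record
      { bijection = record
        { to        = index
        ; from      = at
        ; to-cong   = λ {y} {y′} → index-cong y y′
        ; from-cong = λ { refl X → refl }
        ; inverse   = (λ {x} {y} y≈ → index-cong y (at x) y≈)
                    , (λ {y} → λ { refl X → sym (proj₂ (proj₂ y) X) })
        }
      ; to-continuous   = to-continuous
      ; from-continuous = from-continuous
      }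
      where
      open Space (Subspace ω* Range) using () renaming (Carrier to Y; _≈_ to _≈Y_)

      index : Y → Carrier ⁺
      index (_ , x , _) = x

      at : Carrier ⁺ → Y
      at x = point x , x , λ _ → refl

      index-cong : ∀ y y′ → y ≈Y y′ → index y ≡ index y′
      index-cong (_ , x , y≈x) (_ , x′ , y′≈x′) y≈y′ =
        injective x x′ λ X → trans (sym (y≈x X)) (trans (y≈y′ X) (y′≈x′ X))

      to-continuous : Continuous (Subspace ω* Range) (P[ em ] κ) index
      to-continuous V oV =
        (proj₁ ⊢ W) , (W , oW , id , id)
        , (λ { {_ , x , y≈x} x∈V →
               let (X , X∈x , X⊆V) = separated V oV x x∈V in X , subst T (sym (y≈x X)) X∈x , X⊆V })
        , λ { {_ , x , y≈x} (X , X∈y , X⊆V) → X⊆V x (subst T (y≈x X) X∈y) }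
        where
        -- The largest open set whose trace on the range lies in `V`.
        W : Pred Ultrafilter 0ℓ
        W q = ∃[ X ] T (member q X) × (∀ y → T (member (s y) X) → y ∈ V)
        oW : Space.Open βω W
        oW p (X , X∈p , X⊆V) = X , X∈p , λ q X∈q → X , X∈q , X⊆V

      from-continuous : Continuous (P[ em ] κ) (Subspace ω* Range) at
      from-continuous V (V′ , (V″ , oV″ , V′⊆V″ , V″⊆V′) , V⊆V′ , V′⊆V) with em {at ⊤⁺ ∈ V}
      ... | no ⊤∉V  = inj₁ ⊤∉V
      ... | yes ⊤∈V =
        let (X , X∈⊤ , X⊆V″) = oV″ (s ⊤⁺) (V′⊆V″ (V⊆V′ ⊤∈V))
            (ξ , ξ-tail) = converges X∈⊤
        in inj₂ (ξ , λ
          { [ ξ<α ]    → V′⊆V (V″⊆V′ (X⊆V″ _ (ξ-tail _ ξ<α)))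
          ; [ _ ]<⊤⁺   → ⊤∈V })

    arrow : (P : Pred (Space.Carrier ω*) 0ℓ) → P Respects (Space._≈_ ω*) →
            (∀ x → point x ∈ P) →
            Σ[ Y′ ∈ Pred (Space.Carrier ω*) 0ℓ ]
              Y′ Respects (Space._≈_ ω*) × Y′ ⊆ P × Homeomorphic (Subspace ω* Y′) (P[ em ] κ)
    arrow P P-respects P-all = Range , (λ {y} {y′} → Range-respects {y} {y′})
      , (λ { {y} (x , y≈x) → P-respects {point x} {y} (λ X → sym (y≈x X)) (P-all x) })
      , homeomorphic

-- The tree of ultrafilters and the partition argument.

-- The labels top γ b serve the sequence converging to the root, and sub δ γ b the
-- one converging to the limit of row δ.
data Index (C : Set) : Set where
  top : C → Bool → Index C
  sub : C → C → Bool → Index C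

-- Embeds the labels into the reals, which index the independent family. The first two digits record
-- the Boolean and the constructor; a single ordinal is paired with itself.
code : {C : Set} → (C → ℕ → Bool) → Index C → ℕ → Bool
code real (top γ b)   zero          = b
code real (sub δ γ b) zero          = b
code real (top γ b)   (suc zero)    = false
code real (sub δ γ b) (suc zero)    = true
code real (top γ b)   (suc (suc n)) = interleave (real γ) (real γ) n
code real (sub δ γ b) (suc (suc n)) = interleave (real δ) (real γ) n

code-injective : {C : Set} (real : C → ℕ → Bool) → (∀ {γ δ} → real γ ≗ real δ → γ ≡ δ) →
                 ∀ {i j} → code real i ≗ code real j → i ≡ j
code-injective real inj {top γ b} {top γ′ b′} eq = cong₂ top
  (inj λ k → proj₁ (interleave-injective (λ n → eq (suc (suc n))) k)) (eq 0)
code-injective real inj {sub δ γ b} {sub δ′ γ′ b′} eq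
  with inj (λ k → proj₁ (interleave-injective (λ n → eq (suc (suc n))) k))
     | inj (λ k → proj₂ (interleave-injective (λ n → eq (suc (suc n))) k))
... | refl | refl = cong (sub δ γ) (eq 0)
code-injective real inj {top _ _} {sub _ _ _} eq = contradiction (eq 1) λ ()
code-injective real inj {sub _ _ _} {top _ _} eq = contradiction (eq 1) λ ()

module Tree (em : ExcludedMiddle 0ℓ) (ext : Extensionality 0ℓ 0ℓ)
  (κ : InfiniteCardinal) (uncountable-cf : cf>ω κ)
  (A : Index (InfiniteCardinal.Carrier κ) → ℕ → Bool) (independent : Independent A)
  where

  open InfiniteCardinal κ
  open Classical em
  open Convergence em κ
  open Forcing em ext A independent

  -- Otherwise the image would be cofinal, and choosing a position for each value would inject it
  -- into ω.
  sequence-bounded : (f : ℕ → Carrier) → ∃[ ξ ] (∀ n → f n < ξ)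
  sequence-bounded f = by-contradiction λ unbounded →
    proj₂ (uncountable-cf Image λ α → by-contradiction λ α-above → unbounded
      (α , λ n → by-contradiction λ fn≮α → α-above (f n , (n , refl) , fn≮α)))
    record
      { to        = λ (β , _) → position β
      ; cong      = cong position
      ; injective = λ { {_ , m} {_ , n} eq →
          trans (sym (position-correct _ m)) (trans (cong f eq) (position-correct _ n)) }
      }
    where
    Image : Pred Carrier 0ℓ
    Image β = ∃[ n ] f n ≡ β

    position : Carrier → ℕ
    position β with em {Image β}
    ... | yes (n , _) = n
    ... | no _        = 0

    position-correct : ∀ β → β ∈ Image → f (position β) ≡ β
    position-correct β β∈ with em {Image β}
    ... | yes (_ , eq) = eq
    ... | no β∉        = contradiction β∈ β∉

  ≮-<-trans : ∀ {α β γ} → ¬ (β < α) → β < γ → α < γ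
  ≮-<-trans {α} {β} β≮α β<γ with compare α β
  ... | tri< α<β _ _  = <-trans α<β β<γ
  ... | tri≈ _ refl _ = β<γ
  ... | tri> _ _ β<α  = contradiction β<α β≮α

  list-bounded : ∀ l → ∃[ ξ ] All (λ α → ¬ (ξ < α)) l
  list-bounded []      = Injection.to infinite 0 , []
  list-bounded (α ∷ l) with list-bounded l
  ... | ξ , ≤ξ with compare ξ α
  ...   | tri< ξ<α _ _ = α , <-irrefl ∷ All.map (λ ξ≮ α< → ξ≮ (<-trans ξ<α α<)) ≤ξ
  ...   | tri≈ ξ≮α _ _ = ξ , ξ≮α ∷ ≤ξ
  ...   | tri> ξ≮α _ _ = ξ , ξ≮α ∷ ≤ξ

  support-bounded : (R : ℕ → List (Index Carrier)) (f : Index Carrier → Carrier) →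
                    ∃[ ξ ] (∀ n → All (λ i → f i < ξ) (R n))
  support-bounded R f =
    let (ξ , ξ-bound) = sequence-bounded (λ n → proj₁ (list-bounded (List.map f (R n)))) in
    ξ , λ n → All.map (λ ≮ → ≮-<-trans ≮ (ξ-bound n))
                (map⁻ (proj₂ (list-bounded (List.map f (R n)))))

  -- The values that `label-limit` demands at limits.
  default : Index Carrier → Bool
  default (top _ b)   = b
  default (sub _ _ b) = b

  -- Bounding `first` on a support gives convergence to the root; bounding `second` gives
  -- convergence within a row.
  first : Index Carrier → Carrier
  first (top γ _)   = γ
  first (sub δ _ _) = δ

  second : Index Carrier → Carrier
  second (top γ _)   = γ
  second (sub _ γ _) = γ

  root : Modification (proj₁ F-ultrafilter) ∅ default
  root = modify _ (proj₂ F-ultrafilter) ∅ default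

  module Root = Modification root

  Below : Carrier → Pred (Index Carrier) 0ℓ
  Below α i = first i < α

  -- The branch at `α` is both the point at position `α` of the sequence to the root and the limit
  -- of its own row.
  branch-value : Carrier → Index Carrier → Bool
  branch-value α (top γ b)   = mark α γ b
  branch-value α (sub _ _ b) = b

  branch : ∀ α → Modification Root.result (Below α) (branch-value α)
  branch α = modify _ Root.extends-F (Below α) (branch-value α)

  module Branch α = Modification (branch α)

  -- Labels below `α` keep their root values, which are the required ones because `mark` takes its
  -- limit value at positions beyond `γ`.
  branch-literal : ∀ α i → member (Branch.result α) (A i) ≡ branch-value α i
  branch-literal α i with em {first i < α}
  ... | no i∉ = Branch.outside α i i∉
  ... | yes i∈ = trans (Branch.inside-index α i i∈) (trans (Root.outside i id) (agree i i∈))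
    where
    agree : ∀ i → first i < α → default i ≡ branch-value α i
    agree (top γ b)   γ<α = sym (mark-below γ<α b)
    agree (sub _ _ _) _   = refl

  -- The support of a set bounded by ξ misses the labels sub α of every row α > ξ,
  -- so all points of such a row agree with the root on it.
  Kept : Carrier → Carrier → Pred (Index Carrier) 0ℓ
  Kept α β (top _ _)   = ⊤
  Kept α β (sub δ γ _) = δ ≡ α → γ < β

  leaf-value : Carrier → Index Carrier → Bool
  leaf-value β (top _ b)   = b
  leaf-value β (sub _ γ b) = mark β γ b

  leaf : ∀ α β → Modification (Branch.result α) (Kept α β) (leaf-value β)
  leaf α β = modify _ (Branch.extends-F α) (Kept α β) (leaf-value β)

  module Leaf α β = Modification (leaf α β)

  leaf-top : ∀ α β γ b → member (Leaf.result α β) (A (top γ b)) ≡ mark α γ b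
  leaf-top α β γ b = trans (Leaf.inside-index α β (top γ b) _) (branch-literal α (top γ b))

  leaf-sub : ∀ α β γ b → member (Leaf.result α β) (A (sub α γ b)) ≡ mark β γ b
  leaf-sub α β γ b with em {γ < β}
  ... | no γ≮β  = Leaf.outside α β (sub α γ b) λ kept → γ≮β (kept refl)
  ... | yes γ<β = trans (Leaf.inside-index α β (sub α γ b) (const γ<β))
    (trans (branch-literal α (sub α γ b)) (sym (mark-below γ<β b)))

  vertex : Carrier → Carrier ⁺ → Ultrafilter
  vertex α ⊤⁺    = Branch.result α
  vertex α [ β ] = Leaf.result α β

  vertex-extends-F : ∀ α x → Extends-F (vertex α x)
  vertex-extends-F α ⊤⁺    = Branch.extends-F α
  vertex-extends-F α [ β ] = Leaf.extends-F α β

  vertex-top : ∀ α x γ b → member (vertex α x) (A (top γ b)) ≡ mark α γ b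
  vertex-top α ⊤⁺    γ b = branch-literal α (top γ b)
  vertex-top α [ β ] γ b = leaf-top α β γ b

  -- The bound `ξ` is uniform in `x`, so a transversal may take any point of each row.
  vertex-converges : ∀ {X} → T (member Root.result X) →
                     ∃[ ξ ] (∀ α → ξ < α → ∀ x → T (member (vertex α x) X))
  vertex-converges {X} X∈root =
    let (R , supported) = countable-support X
        (ξ , R<ξ) = support-bounded R first
    in ξ , λ α ξ<α → limit-or-leaf α (in-branch R supported R<ξ ξ<α) (in-kept R supported R<ξ ξ<α)
    where
    module _ (R : ℕ → List (Index Carrier)) (supported : ∀ K → (∀ n → All K (R n)) → Supported K X)
      {ξ} (R<ξ : ∀ n → All (λ i → first i < ξ) (R n)) {α} (ξ<α : ξ < α) where

      in-branch : T (member (Branch.result α) X)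
      in-branch = Branch.inside α (supported _ λ n → All.map (λ i<ξ → <-trans i<ξ ξ<α) (R<ξ n)) X∈root

      keep : ∀ β i → first i < ξ → i ∈ Kept α β
      keep β (top _ _)   _   = _
      keep β (sub _ _ _) i<ξ = λ { refl → contradiction (<-trans i<ξ ξ<α) <-irrefl }

      in-kept : ∀ β → Supported (Kept α β) X
      in-kept β = supported _ λ n → All.map (λ {i} → keep β i) (R<ξ n)

    limit-or-leaf : ∀ α → T (member (Branch.result α) X) → (∀ β → Supported (Kept α β) X) →
                    ∀ x → T (member (vertex α x) X)
    limit-or-leaf α X∈ sup ⊤⁺    = X∈
    limit-or-leaf α X∈ sup [ β ] = Leaf.inside α β (sup β) X∈

  -- Only labels of row `α` itself can fail to be kept, and beyond a bound on `second` none in the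
  -- support does.
  leaf-converges : ∀ α {X} → T (member (Branch.result α) X) →
                   ∃[ ξ ] (∀ β → ξ < β → T (member (Leaf.result α β) X))
  leaf-converges α {X} X∈ =
    let (R , supported) = countable-support X
        (ξ , R<ξ) = support-bounded R second
    in ξ , λ β ξ<β → Leaf.inside α β
         (supported _ λ n → All.map (λ {i} i<ξ → keep β i (<-trans i<ξ ξ<β)) (R<ξ n)) X∈
    where
    keep : ∀ β i → second i < β → i ∈ Kept α β
    keep β (top _ _)   _   = _
    keep β (sub _ _ _) i<β = const i<β

  transversal : (Carrier → Carrier ⁺) → Carrier ⁺ → Ultrafilter
  transversal x ⊤⁺    = Root.result
  transversal x [ α ] = vertex α (x α)

  transversal-convergent : ∀ x → Convergent (transversal x)
  transversal-convergent x = record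
    { nonprincipal = λ { ⊤⁺    → nonprincipal {Root.result} Root.extends-F
                       ; [ α ] → nonprincipal {vertex α (x α)} (vertex-extends-F α (x α)) }
    ; label        = λ γ b → A (top γ b)
    ; label-point  = λ α → vertex-top α (x α)
    ; label-limit  = λ γ b → Root.outside (top γ b) id
    ; converges    = λ X∈ → let (ξ , tail) = vertex-converges X∈ in ξ , λ α ξ<α → tail α ξ<α (x α)
    }

  vertex-convergent : ∀ α → Convergent (vertex α)
  vertex-convergent α = record
    { nonprincipal = λ x → nonprincipal {vertex α x} (vertex-extends-F α x)
    ; label        = λ γ b → A (sub α γ b)
    ; label-point  = λ β → leaf-sub α β
    ; label-limit  = λ γ b → branch-literal α (sub α γ b)
    ; converges    = leaf-converges α
    }

  partition : ω* ⟶⟨ P[ em ] κ ⟩¹₂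
  partition P P-respects cover = monochromatic (cover root-point)
    where
    root-point : Space.Carrier ω*
    root-point = Root.result , nonprincipal {Root.result} Root.extends-F

    vertex-point : Carrier → Carrier ⁺ → Space.Carrier ω*
    vertex-point α x = vertex α x , nonprincipal {vertex α x} (vertex-extends-F α x)

    other : Fin 2 → Fin 2
    other zero       = suc zero
    other (suc zero) = zero

    otherwise : ∀ i y → y ∉ P i → y ∈ P (other i)
    otherwise i y y∉ with cover y
    otherwise zero       y y∉ | zero     , y∈ = contradiction y∈ y∉
    otherwise zero       y y∉ | suc zero , y∈ = y∈
    otherwise (suc zero) y y∉ | zero     , y∈ = y∈
    otherwise (suc zero) y y∉ | suc zero , y∈ = contradiction y∈ y∉

    monochromatic : ∃[ i ] root-point ∈ P i →
           ∃[ i ] Σ[ Y′ ∈ Pred (Space.Carrier ω*) 0ℓ ]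
             Y′ Respects (Space._≈_ ω*) × Y′ ⊆ P i × Homeomorphic (Subspace ω* Y′) (P[ em ] κ)
    monochromatic (i , root∈Pi) with em {∀ α → ∃[ x ] vertex-point α x ∈ P i}
    ... | yes meets = i , Convergent.arrow (transversal-convergent (proj₁ ∘ meets)) (P i)
      (λ {y} {y′} → P-respects i {y} {y′}) λ { ⊤⁺ → root∈Pi ; [ α ] → proj₂ (meets α) }
    ... | no ¬meets with ¬∀⇒∃¬ ¬meets
    ...   | α , avoids = other i , Convergent.arrow (vertex-convergent α) (P (other i))
      (λ {y} {y′} → P-respects (other i) {y} {y′}) λ
        { ⊤⁺    → otherwise i (vertex-point α ⊤⁺) λ ∈Pi → avoids (⊤⁺ , ∈Pi)
        ; [ β ] → otherwise i (vertex-point α [ β ]) λ ∈Pi → avoids ([ β ] , ∈Pi) }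

theorem4p3 : (em : ∀ {ℓ} → ExcludedMiddle ℓ) → (∀ {a b} → Extensionality a b) →
    (κ : InfiniteCardinal) →
    ω₁ ≼ InfiniteCardinal.setoid κ → InfiniteCardinal.setoid κ ≼ 𝔠 →
    cf>ω κ →
    ω* ⟶⟨ P[ em ] κ ⟩¹₂
theorem4p3 em ext κ _ κ≼𝔠 uncountable-cf =
  Tree.partition em ext κ uncountable-cf (family (code real)) (family-independent em (code real)
    (code-injective real (Injection.injective κ≼𝔠)))
  where
  real : InfiniteCardinal.Carrier κ → ℕ → Bool
  real = Injection.to κ≼𝔠
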